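{- Let $0<q<1$, let $k\ge 1$ and $n\ge 1$ be integers, and let $r_1,\dots,r_k$ be real numbers with $0\le r_j<\infty$. Let $X_j$ be the number of successes of the $j$-th kind, $j=1,\dots,k$, in a sequence of $n$ independent Bernoulli trials with chain-composite failures (see context), where the probability of success of the $j$-th kind at the $i$-th trial is $$p_{j,i}=\frac{1}{[r_j+i]_q},\qquad j=1,2,\ldots,k,\ i=1,2,\ldots .$$ Then the probability function of the random vector $(X_1,X_2,\ldots,X_k)$ is given by $$P(X_1=x_1,X_2=x_2,\ldots,X_k=x_k)=\frac{q^{nk-\sum_{j=1}^k(k-j+1)x_j}}{\prod_{j=1}^k\left[r_j+n-\sum_{\nu=0}^{j-1}x_\nu\right]_{n-\sum_{\nu=0}^{j-1}x_\nu,\,q}}\cdot\sum\prod_{j=1}^k [r_j+m_{j,1}]_q[r_j+m_{j,2}]_q\cdots\left[r_j+m_{j,\,n-\sum_{\nu=1}^j x_\nu}\right]_q$$ for all $x_j\in\{0,1,\ldots,n\}$, $j=1,\dots,k$, with $\sum_{j=1}^k x_j\le n$, where $x_0=0$ and the multiple sum is extended over all choices, for each $j=1,\dots,k$, of an $\left(n-\sum_{\nu=1}^j x_\nu\right)$-combination (subset) $\{m_{j,1},m_{j,2},\ldots,m_{j,\,n-\sum_{\nu=1}^{j}x_\nu}\}$ of the $n-\sum_{\nu=0}^{j-1}x_\nu$ nonnegative integers $\{0,1,\ldots,n-\sum_{\nu=0}^{j-1}x_\nu-1\}$.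
   Context: $q$-numbers: for real $t$, $[t]_q=\frac{1-q^t}{1-q}$. The $q$-falling factorial of order $N$ is $[t]_{N,q}=[t]_q[t-1]_q\cdots[t-N+1]_q$, with $[t]_{0,q}=1$. An empty product equals $1$. In the multiple sum, the subsets for different $j$ are chosen independently. Independent Bernoulli trials with chain-composite failures (with $k$ kinds of success and success probabilities $p_{j,i}$): first, $n$ independent trials numbered $i=1,\dots,n$ are performed, the $i$-th one being a success of the first kind with probability $p_{1,i}$; $X_1$ is the number of successes of the first kind. The failures are then subjected to trials of the second kind: given $X_1=x_1$, one performs $n-x_1$ independent trials numbered $i=1,\dots,n-x_1$, the $i$-th being a success of the second kind with probability $p_{2,i}$; $X_2$ is the number of successes. In general, given $X_1=x_1,\dots,X_{j-1}=x_{j-1}$, one performs $n-\sum_{\nu=0}^{j-1}x_\nu$ (with $x_0=0$) independent trials of the $j$-th kind, numbered $i=1,\dots,n-\sum_{\nu=0}^{j-1}x_\nu$, the $i$-th of which is a success of the $j$-th kind with probability $p_{j,i}$ and a failure with probability $1-p_{j,i}$, independently of the earlier stages apart from the number of trials; $X_j$ is the number of successes of the $j$-th kind. Thus the probability of any specified pattern of successes and failures in all $k$ stages is the product over $j=1,\dots,k$ of the corresponding factors $p_{j,i}$ (successes) and $1-p_{j,i}$ (failures). -}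

module Defs where

open import Level using (_⊔_) renaming (suc to lsuc)
open import Algebra.Apartness.Bundles using (HeytingField; HeytingCommutativeRing)
open import Algebra.Bundles using (CommutativeRing)
open import Data.Empty using (⊥-elim)
open import Data.Fin.Base using (Fin; zero; suc; toℕ)
open import Data.Fin.Properties using (all?; toℕ<n)
open import Data.Fin.Subset using (Subset; inside; outside; ∣_∣; ∁)
open import Data.List.Base using (List; []; _∷_; [_]; _++_; map; concatMap; cartesianProductWith; filter; foldr)
open import Data.Nat.Base as ℕ using (ℕ; zero; suc; _∸_; NonZero)
import Data.Nat.Properties as ℕ
open import Data.Product.Base using (∃-syntax; _×_; _,_; proj₁; proj₂)
open import Data.Sum.Base using (_⊎_; inj₁; inj₂)
open import Data.Vec.Base using ([]; _∷_)
open import Data.Vec.Functional using (Vector)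
open import Function.Base using (_∘_)
open import Function.Bundles using (_⇔_; Equivalence)
open import Relation.Binary.Core using (Rel)
open import Relation.Binary.Definitions using (Cotransitive)
open import Relation.Binary.PropositionalEquality.Core using (_≗_)
open import Relation.Binary.Structures using (IsStrictPartialOrder)
open import Relation.Nullary.Negation.Core using (¬_)
open import Relation.Unary using (Pred; Decidable)
import Algebra.Definitions.RawMonoid as RawMonoidDefs
import Algebra.Properties.Monoid.Sum as MonoidSum
import Algebra.Properties.Ring as RingProperties
import Relation.Binary.Reasoning.Setoid as SetoidReasoning

-- The real numbers, axiomatised as a Cauchy-complete Archimedean ordered
-- field with real powers of positive bases.  Classically these axioms
-- determine the field up to unique isomorphism, and the power function on it
-- uniquely; they are phrased so as to hold constructively as well (apartness
-- and cotransitivity instead of decidable equality and trichotomy).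
record RealNumbers c ℓ₁ ℓ₂ : Set (lsuc (c ⊔ ℓ₁ ⊔ ℓ₂)) where
  field
    heytingField : HeytingField c ℓ₁ ℓ₂

  open HeytingField heytingField public hiding (zero)
  open HeytingCommutativeRing heytingCommutativeRing public using (commutativeRing)
  open CommutativeRing commutativeRing public
    using (ring; *-monoid; +-rawMonoid)
  open RawMonoidDefs +-rawMonoid using () renaming (_×_ to _⋆_)

  infix 4 _<_ _≤_
  field
    _<_                  : Rel Carrier ℓ₂
    isStrictPartialOrder : IsStrictPartialOrder _≈_ _<_
    <-cotrans            : Cotransitive _<_
    #⇔<⊎>                : ∀ {x y} → x # y ⇔ (x < y ⊎ y < x)
    0<1                  : 0# < 1#
    +-monoʳ-<            : ∀ z {x y} → x < y → z + x < z + y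
    *-pos                : ∀ {x y} → 0# < x → 0# < y → 0# < x * y

  _≤_ : Rel Carrier ℓ₂
  x ≤ y = ¬ (y < x)

  ι : ℕ → Carrier
  ι n = n ⋆ 1#

  Cauchy : (ℕ → Carrier) → Set (c ⊔ ℓ₂)
  Cauchy a = ∀ ε → 0# < ε → ∃[ N ] ∀ m n → N ℕ.≤ m → N ℕ.≤ n → a m < a n + ε

  _ConvergesTo_ : (ℕ → Carrier) → Carrier → Set (c ⊔ ℓ₂)
  a ConvergesTo l = ∀ ε → 0# < ε → ∃[ N ] ∀ n → N ℕ.≤ n → (a n < l + ε) × (l < a n + ε)

  field
    archimedean : ∀ x → ∃[ n ] x < ι n
    complete    : ∀ a → Cauchy a → ∃[ l ] a ConvergesTo l

    pow         : ∀ b → 0# < b → Carrier → Carrier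
    pow-cong    : ∀ {b c s t} {0<b : 0# < b} {0<c : 0# < c} →
                  b ≈ c → s ≈ t → pow b 0<b s ≈ pow c 0<c t
    pow-pos     : ∀ {b t} {0<b : 0# < b} → 0# < pow b 0<b t
    pow-1       : ∀ {b} {0<b : 0# < b} → pow b 0<b 1# ≈ b
    pow-+       : ∀ {b s t} {0<b : 0# < b} →
                  pow b 0<b (s + t) ≈ pow b 0<b s * pow b 0<b t
    pow-*       : ∀ {b c t} {0<b : 0# < b} {0<c : 0# < c} →
                  pow (b * c) (*-pos 0<b 0<c) t ≈ pow b 0<b t * pow c 0<c t
    pow-monoʳ-< : ∀ {b s t} {0<b : 0# < b} → 1# < b → s < t →
                  pow b 0<b s < pow b 0<b t

module RealProperties {c ℓ₁ ℓ₂} (ℝ : RealNumbers c ℓ₁ ℓ₂) where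
  open RealNumbers ℝ
  open IsStrictPartialOrder isStrictPartialOrder public
    using (<-respʳ-≈; <-respˡ-≈) renaming (trans to <-trans; irrefl to <-irrefl)
  open MonoidSum *-monoid public using () renaming (sum to ∏)
  open RingProperties ring using (-0#≈0#; -‿distribʳ-*)
  open SetoidReasoning setoid

  x-0≈x : ∀ x → x - 0# ≈ x
  x-0≈x x = trans (+-congˡ -0#≈0#) (+-identityʳ x)

  x<y⇒0<y-x : ∀ {x y} → x < y → 0# < y - x
  x<y⇒0<y-x {x} {y} x<y =
    <-respʳ-≈ (+-comm (- x) y) (<-respˡ-≈ (-‿inverseˡ x) (+-monoʳ-< (- x) x<y))

  0<y-x⇒x<y : ∀ {x y} → 0# < y - x → x < y
  0<y-x⇒x<y {x} {y} 0<y-x =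
    <-respʳ-≈ eq (<-respˡ-≈ (+-identityʳ x) (+-monoʳ-< x 0<y-x))
    where
    eq : x + (y - x) ≈ y
    eq = begin
      x + (y - x)     ≈⟨ +-comm _ _ ⟩
      (y - x) + x     ≈⟨ +-assoc y (- x) x ⟩
      y + (- x + x)   ≈⟨ +-congˡ (-‿inverseˡ x) ⟩
      y + 0#          ≈⟨ +-identityʳ y ⟩
      y               ∎

  x<0⇒0<-x : ∀ {x} → x < 0# → 0# < - x
  x<0⇒0<-x x<0 = <-respʳ-≈ (+-identityˡ _) (x<y⇒0<y-x x<0)

  *-monoʳ-< : ∀ {x y z} → 0# < z → x < y → z * x < z * y
  *-monoʳ-< {x} {y} {z} 0<z x<y = 0<y-x⇒x<y (<-respʳ-≈ eq (*-pos 0<z (x<y⇒0<y-x x<y)))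
    where
    eq : z * (y - x) ≈ z * y - z * x
    eq = trans (distribˡ z y (- x)) (+-congˡ (sym (-‿distribʳ-* z x)))

  +-pos : ∀ {x y} → 0# ≤ x → 0# < y → 0# < x + y
  +-pos {x} {y} 0≤x 0<y with <-cotrans 0<y (x + y)
  ... | inj₁ 0<x+y = 0<x+y
  ... | inj₂ x+y<y = ⊥-elim (0≤x (<-respʳ-≈ (-‿inverseʳ y)
          (<-respˡ-≈ eq (<-respʳ-≈ (+-comm (- y) y) (+-monoʳ-< (- y) x+y<y)))))
    where
    eq : - y + (x + y) ≈ x
    eq = begin
      - y + (x + y)   ≈⟨ +-comm _ _ ⟩
      (x + y) - y     ≈⟨ +-assoc x y (- y) ⟩
      x + (y - y)     ≈⟨ +-congˡ (-‿inverseʳ y) ⟩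
      x + 0#          ≈⟨ +-identityʳ x ⟩
      x               ∎

  0<⇒0≤ : ∀ {x} → 0# < x → 0# ≤ x
  0<⇒0≤ 0<x x<0 = <-irrefl refl (<-trans 0<x x<0)

  0≤ι : ∀ n → 0# ≤ ι n
  0<ι-suc : ∀ n → 0# < ι (suc n)
  0≤ι zero    = <-irrefl refl
  0≤ι (suc n) = 0<⇒0≤ (0<ι-suc n)
  0<ι-suc n = <-respʳ-≈ (+-comm (ι n) 1#) (+-pos (0≤ι n) 0<1)

  0<ι : ∀ n → .{{_ : NonZero n}} → 0# < ι n
  0<ι (suc n) = 0<ι-suc n

  ι-mono-< : ∀ {m n} → m ℕ.< n → ι m < ι n
  ι-mono-< {zero}  {suc n} _             = 0<ι-suc n
  ι-mono-< {suc m} {suc n} (ℕ.s≤s m<n) = +-monoʳ-< 1# (ι-mono-< m<n)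

  ∏-pos : ∀ {k} (f : Vector Carrier k) → (∀ j → 0# < f j) → 0# < ∏ f
  ∏-pos {zero}  f 0<f = 0<1
  ∏-pos {suc k} f 0<f = *-pos (0<f zero) (∏-pos (f ∘ suc) (0<f ∘ suc))

  invert : ∀ {y} → 0# < y → ∃[ z ] z * y ≈ 1#
  invert {y} 0<y with #⇒invertible (Equivalence.from #⇔<⊎> (inj₂ 0<y))
  ... | z , z*[y-0]≈1 , _ = z , trans (*-congˡ (sym (x-0≈x y))) z*[y-0]≈1

  recip : ∀ y → 0# < y → Carrier
  recip y 0<y = proj₁ (invert 0<y)

  recip-inverseˡ : ∀ {y} (0<y : 0# < y) → recip y 0<y * y ≈ 1#
  recip-inverseˡ 0<y = proj₂ (invert 0<y)

  recip-pos : ∀ {y} (0<y : 0# < y) → 0# < recip y 0<y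
  recip-pos {y} 0<y with Equivalence.to #⇔<⊎> z#0
    where
    z = recip y 0<y
    z#0 : z # 0#
    z#0 = invertible⇒#
      ( y
      , trans (*-congˡ (x-0≈x z)) (trans (*-comm y z) (recip-inverseˡ 0<y))
      , trans (*-congʳ (x-0≈x z)) (recip-inverseˡ 0<y))
  ... | inj₂ 0<z = 0<z
  ... | inj₁ z<0 = ⊥-elim (<-irrefl refl (<-trans 0<1 1<0))
    where
    z = recip y 0<y
    0<-1 : 0# < - 1#
    0<-1 = <-respʳ-≈ (trans (sym (-‿distribʳ-* y z))
             (-‿cong (trans (*-comm y z) (recip-inverseˡ 0<y))))
             (*-pos 0<y (x<0⇒0<-x z<0))
    1<0 : 1# < 0#
    1<0 = <-respʳ-≈ (-‿inverseʳ 1#) (<-respˡ-≈ (+-identityʳ 1#) (+-monoʳ-< 1# 0<-1))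

  infixl 7 _/_⟨_⟩
  _/_⟨_⟩ : Carrier → (y : Carrier) → 0# < y → Carrier
  x / y ⟨ 0<y ⟩ = x * recip y 0<y

  x*x≈x⇒x≈1 : ∀ {x} → 0# < x → x * x ≈ x → x ≈ 1#
  x*x≈x⇒x≈1 {x} 0<x x*x≈x = begin
    x             ≈⟨ *-identityˡ x ⟨
    1# * x        ≈⟨ *-congʳ (recip-inverseˡ 0<x) ⟨
    (z * x) * x   ≈⟨ *-assoc z x x ⟩
    z * (x * x)   ≈⟨ *-congˡ x*x≈x ⟩
    z * x         ≈⟨ recip-inverseˡ 0<x ⟩
    1#            ∎
    where z = recip x 0<x

  pow-0 : ∀ {b} {0<b : 0# < b} → pow b 0<b 0# ≈ 1#
  pow-0 {b} = x*x≈x⇒x≈1 pow-pos (trans (sym pow-+) (pow-cong refl (+-identityʳ 0#)))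

  1-pow : ∀ {t} → pow 1# 0<1 t ≈ 1#
  1-pow = x*x≈x⇒x≈1 pow-pos (trans (sym pow-*) (pow-cong (*-identityʳ 1#) refl))

  pow<1 : ∀ {b t} {0<b : 0# < b} → b < 1# → 0# < t → pow b 0<b t < 1#
  pow<1 {b} {t} {0<b} b<1 0<t =
    <-respʳ-≈ z^t*b^t≈1 (<-respˡ-≈ (*-identityʳ _) (*-monoʳ-< pow-pos 1<z^t))
    where
    z = recip b 0<b
    0<z = recip-pos 0<b
    1<z : 1# < z
    1<z = <-respʳ-≈ (*-identityʳ z) (<-respˡ-≈ (recip-inverseˡ 0<b) (*-monoʳ-< 0<z b<1))
    1<z^t : 1# < pow z 0<z t
    1<z^t = <-respˡ-≈ pow-0 (pow-monoʳ-< 1<z 0<t)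
    z^t*b^t≈1 : pow b 0<b t * pow z 0<z t ≈ 1#
    z^t*b^t≈1 = trans (sym pow-*)
      (trans (pow-cong (trans (*-comm b z) (recip-inverseˡ 0<b)) refl) 1-pow)

module _ {c ℓ₁ ℓ₂} (ℝ : RealNumbers c ℓ₁ ℓ₂) where
  open RealNumbers ℝ
  open RealProperties ℝ

  -- [t]_q and [t]_{N,q} for 0 < q < 1, with the positivity facts that make
  -- division by them legitimate.
  module QNumbers (q : Carrier) (0<q : 0# < q) (q<1 : q < 1#) where

    q^_ : Carrier → Carrier
    q^ t = pow q 0<q t

    [_]q : Carrier → Carrier
    [ t ]q = (1# - q^ t) / (1# - q) ⟨ x<y⇒0<y-x q<1 ⟩

    [_]↓_ : Carrier → ℕ → Carrier
    [ t ]↓ N = ∏ {N} λ i → [ t - ι (toℕ i) ]q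

    []q-pos : ∀ {t} → 0# < t → 0# < [ t ]q
    []q-pos 0<t = *-pos (x<y⇒0<y-x (pow<1 q<1 0<t)) (recip-pos _)

    [r+i]q-pos : ∀ {r} → 0# ≤ r → ∀ i → .{{_ : NonZero i}} → 0# < [ r + ι i ]q
    [r+i]q-pos 0≤r i = []q-pos (+-pos 0≤r (0<ι i))

    [r+N]↓N-pos : ∀ {r} → 0# ≤ r → ∀ N → 0# < [ r + ι N ]↓ N
    [r+N]↓N-pos {r} 0≤r N = ∏-pos {N} _ λ i → []q-pos
      (<-respʳ-≈ (sym (+-assoc r (ι N) (- ι (toℕ i))))
        (+-pos 0≤r (x<y⇒0<y-x (ι-mono-< (toℕ<n i)))))

open MonoidSum ℕ.+-0-monoid public using () renaming (sum to ∑ℕ)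

subsets : ∀ n → List (Subset n)
subsets zero    = [ [] ]
subsets (suc n) = map (outside ∷_) (subsets n) ++ map (inside ∷_) (subsets n)

combinations : ∀ m N → List (Subset N)
combinations m N = filter (λ s → ∣ s ∣ ℕ.≟ m) (subsets N)

families : ∀ {a k} {A : Fin k → Set a} → (∀ j → List (A j)) → List (∀ j → A j)
families {k = zero}  as = [ (λ ()) ]
families {k = suc k} {A} as = cartesianProductWith cons (as zero) (families (as ∘ suc))
  where
  cons : A zero → (∀ j → A (suc j)) → ∀ j → A j
  cons a f zero    = a
  cons a f (suc j) = f j

-- With kinds indexed from zero, `before x j` is the sum of x_ν over ν < j and
-- `upto x j` the sum over ν ≤ j.
before upto : ∀ {k} → Vector ℕ k → Fin k → ℕ
before x zero    = 0
before x (suc j) = x zero ℕ.+ before (x ∘ suc) j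
upto x j = before x j ℕ.+ x j

-- The results of k stages of trials on n items: the set of successful trials
-- at the first stage, then the results of the remaining stages, which are
-- performed on the failures only.  Trial number i is represented by the
-- element i ∸ 1 of Fin n.
data Outcome : ℕ → ℕ → Set where
  []  : ∀ {n} → Outcome 0 n
  _∷_ : ∀ {k n} (s : Subset n) → Outcome k (n ∸ ∣ s ∣) → Outcome (suc k) n

outcomes : ∀ k n → List (Outcome k n)
outcomes zero    n = [ [] ]
outcomes (suc k) n = concatMap (λ s → map (s ∷_) (outcomes k (n ∸ ∣ s ∣))) (subsets n)

X : ∀ {k n} → Outcome k n → Vector ℕ k
X (s ∷ ω) zero    = ∣ s ∣
X (s ∷ ω) (suc j) = X ω j

X≟ : ∀ {k n} (x : Vector ℕ k) → Decidable (λ (ω : Outcome k n) → X ω ≗ x)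
X≟ x ω = all? λ j → X ω j ℕ.≟ x j

module ChainComposite {c ℓ₁ ℓ₂} (ℝ : RealNumbers c ℓ₁ ℓ₂) where
  open RealNumbers ℝ
  open RealProperties ℝ

  ∑-list : ∀ {a} {A : Set a} → List A → (A → Carrier) → Carrier
  ∑-list as f = foldr (λ a t → f a + t) 0# as

  syntax ∑-list as (λ a → e) = ∑[ a ∈ as ] e

  ∏-subset : ∀ {n} → Subset n → (Fin n → Carrier) → Carrier
  ∏-subset []            f = 1#
  ∏-subset (outside ∷ s) f = ∏-subset s (f ∘ suc)
  ∏-subset (inside  ∷ s) f = f zero * ∏-subset s (f ∘ suc)

  syntax ∏-subset s (λ i → e) = ∏[ i ∈ s ] e

  SuccessProbabilities : ℕ → Set c
  SuccessProbabilities k = Fin k → (i : ℕ) → .{{NonZero i}} → Carrier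

  mass : ∀ {k n} → SuccessProbabilities k → Outcome k n → Carrier
  mass p []      = 1#
  mass p (s ∷ ω) =
      (∏[ i ∈ s ] p zero (suc (toℕ i)))
    * (∏[ i ∈ ∁ s ] (1# - p zero (suc (toℕ i))))
    * mass (λ j → p (suc j)) ω

  ℙ : ∀ {k n ℓ} → SuccessProbabilities k → {E : Pred (Outcome k n) ℓ} → Decidable E → Carrier
  ℙ {k} {n} p E? = ∑[ ω ∈ filter E? (outcomes k n) ] mass p ω

{-# OPTIONS --safe #-}
-- Since [t+1] = 1 + q [t], the failure probability at trial i is
-- 1 − 1/[r+i] = q [r+i−1] / [r+i].  Hence at a stage of N trials every pattern
-- carries the common factor 1 / ([r+1] ⋯ [r+N]), together with a factor q [r+i−1]
-- for each failure i, and the sum over patterns becomes a sum over failure sets.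
-- A stage influences the later ones only through its number of failures, so the
-- stage probabilities multiply, and the product of the sums expands into the
-- multiple sum.
module Submission where

open import Defs
open import Algebra.Bundles using (CommutativeRing)
open import Data.Bool.Base using (if_then_else_)
open import Data.Fin.Base using (Fin; zero; suc; toℕ)
open import Data.Fin.Permutation using (reverse; _⟨$⟩ʳ_)
open import Data.Fin.Properties using (opposite-prop; toℕ<n)
open import Data.Fin.Subset using (Subset; inside; outside; ∣_∣; ∁)
open import Data.Fin.Subset.Properties using (∣p∣≤n; ∣∁p∣≡n∸∣p∣)
open import Data.List.Base using (List; []; _∷_; _++_; map; concatMap; cartesianProductWith; filter)
open import Data.Nat.Base as ℕ using (ℕ; zero; suc; _∸_; NonZero)
import Data.Nat.Properties as ℕ
open import Data.Nat.Solver using (module +-*-Solver)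
open import Data.Vec.Base using ([]; _∷_)
open import Data.Vec.Functional using (Vector)
open import Function.Base using (_∘_)
open import Function.Bundles using (_⇔_; mk⇔; Equivalence)
open import Level using (Level)
open import Relation.Binary.PropositionalEquality as ≡ using (_≡_)
open import Relation.Nullary.Decidable using (Dec; yes; no; does; does-⇔)
open import Relation.Nullary.Negation using (contradiction)
open import Relation.Unary using (Pred; Decidable)
import Algebra.Properties.AbelianGroup as AbelianGroupProperties
import Algebra.Properties.CommutativeMonoid.Sum as CommutativeMonoidSum
import Algebra.Properties.CommutativeSemigroup as CommutativeSemigroupProperties
import Algebra.Properties.Monoid.Mult as MonoidMult
import Algebra.Properties.Monoid.Sum as MonoidSum
import Algebra.Properties.Ring as RingProperties
import Relation.Binary.Reasoning.Setoid as SetoidReasoning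

private
  variable
    a b ℓ ℓ′ : Level
    A : Set a
    B : Set b
    C : Set ℓ
    k n : ℕ

-- Counting failures over all stages.

upto≤∑ : (x : Vector ℕ k) (j : Fin k) → upto x j ℕ.≤ ∑ℕ x
upto≤∑ x zero    = ℕ.m≤m+n (x zero) _
upto≤∑ x (suc j) = begin
  x zero ℕ.+ before (x ∘ suc) j ℕ.+ x (suc j)   ≡⟨ ℕ.+-assoc (x zero) _ _ ⟩
  x zero ℕ.+ upto (x ∘ suc) j                   ≤⟨ ℕ.+-monoʳ-≤ (x zero) (upto≤∑ (x ∘ suc) j) ⟩
  ∑ℕ x                                          ∎
  where open ℕ.≤-Reasoning

-- Double counting of `n` items times `k` stages: an item that succeeds at stage `j` (from zero) has
-- failed in `j` stages and accounts for the other `k ∸ toℕ j`; an item that never succeeds fails in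
-- all `k`. This is the exponent of `q`, in an additive form that avoids truncated subtraction. The
-- induction removes the first stage, leaving `n ∸ x zero` trials.
∑-failures : ∀ k (x : Vector ℕ k) n → ∑ℕ x ℕ.≤ n →
  ∑ℕ (λ j → n ∸ upto x j) ℕ.+ ∑ℕ (λ j → (k ∸ toℕ j) ℕ.* x j) ≡ n ℕ.* k
∑-failures zero    x n ∑x≤n = ≡.sym (ℕ.*-zeroʳ n)
∑-failures (suc k) x n ∑x≤n = begin
  (m ℕ.+ ∑ℕ (λ j → n ∸ upto x (suc j))) ℕ.+ (suc k ℕ.* x₀ ℕ.+ S)
    ≡⟨ ≡.cong (λ F → (m ℕ.+ F) ℕ.+ (suc k ℕ.* x₀ ℕ.+ S)) (MonoidSum.sum-cong-≗ ℕ.+-0-monoid shift) ⟩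
  (m ℕ.+ F) ℕ.+ (suc k ℕ.* x₀ ℕ.+ S)
    ≡⟨ solve 5 (λ m F k x S → (m :+ F) :+ (k :* x :+ S) := m :+ (F :+ S) :+ k :* x)
         ≡.refl m F (suc k) x₀ S ⟩
  m ℕ.+ (F ℕ.+ S) ℕ.+ suc k ℕ.* x₀
    ≡⟨ ≡.cong (λ t → m ℕ.+ t ℕ.+ suc k ℕ.* x₀)
         (∑-failures k (x ∘ suc) m (≡.subst (ℕ._≤ m) (ℕ.m+n∸m≡n x₀ _) (ℕ.∸-monoˡ-≤ x₀ ∑x≤n))) ⟩
  m ℕ.+ m ℕ.* k ℕ.+ suc k ℕ.* x₀
    ≡⟨ solve 3 (λ m k x → m :+ m :* k :+ (con 1 :+ k) :* x := (x :+ m) :* (con 1 :+ k)) ≡.refl m k x₀ ⟩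
  (x₀ ℕ.+ m) ℕ.* suc k
    -- The bound on the total gives `x₀ ≤ n`, so the truncated subtraction in `m` can be undone.
    ≡⟨ ≡.cong (ℕ._* suc k) (ℕ.m+[n∸m]≡n (ℕ.≤-trans (ℕ.m≤m+n x₀ _) ∑x≤n)) ⟩
  n ℕ.* suc k ∎
  where
  open ≡.≡-Reasoning
  open +-*-Solver
  x₀ = x zero
  m  = n ∸ x₀
  F  = ∑ℕ (λ j → m ∸ upto (x ∘ suc) j)
  S  = ∑ℕ (λ j → (k ∸ toℕ j) ℕ.* x (suc j))
  shift : ∀ j → n ∸ upto x (suc j) ≡ m ∸ upto (x ∘ suc) j
  shift j = ≡.trans (≡.cong (n ∸_) (ℕ.+-assoc x₀ _ _)) (≡.sym (ℕ.∸-+-assoc n x₀ _))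

-- The backward direction needs `m ≤ N`: truncated subtraction from `N` is injective on numbers up
-- to `N`, but not beyond.
∣∁∣-⇔ : ∀ {m N} → m ℕ.≤ N → (s : Subset N) → (∣ s ∣ ≡ m) ⇔ (∣ ∁ s ∣ ≡ N ∸ m)
∣∁∣-⇔ {m} {N} m≤N s = mk⇔
  (λ ∣s∣≡m → ≡.trans (∣∁p∣≡n∸∣p∣ s) (≡.cong (N ∸_) ∣s∣≡m))
  (λ ∣∁s∣≡N∸m → ℕ.∸-cancelˡ-≡ (∣p∣≤n s) m≤N (≡.trans (≡.sym (∣∁p∣≡n∸∣p∣ s)) ∣∁s∣≡N∸m))

module _ {c ℓ₁ ℓ₂} (ℝ : RealNumbers c ℓ₁ ℓ₂) where
  open RealNumbers ℝ
  open RealProperties ℝ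
  open ChainComposite ℝ
  open CommutativeRing commutativeRing using
    (+-commutativeMonoid; *-commutativeMonoid; +-abelianGroup; +-monoid)
  open RingProperties ring using (-‿distribʳ-*)
  open AbelianGroupProperties +-abelianGroup using (xyx⁻¹≈y; \\-leftDividesʳ)
  open CommutativeMonoidSum *-commutativeMonoid using () renaming
    ( sum-cong-≋ to ∏-cong; ∑-distrib-+ to ∏-distrib-*
    ; sum-permute to ∏-permute; sum-replicate-zero to ∏-1)
  open CommutativeSemigroupProperties (CommutativeRing.*-commutativeSemigroup commutativeRing)
    using (x∙yz≈y∙xz) renaming (interchange to *-interchange)
  open MonoidMult +-monoid using (×-homo-+)
  open SetoidReasoning setoid

  -- Finite sums over lists and over subsets.

  ∑-cong : ∀ {f g : A → Carrier} (as : List A) → (∀ a → f a ≈ g a) → ∑-list as f ≈ ∑-list as g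
  ∑-cong []       f≈g = refl
  ∑-cong (a ∷ as) f≈g = +-cong (f≈g a) (∑-cong as f≈g)

  ∑-++ : ∀ (as bs : List A) {f : A → Carrier} → ∑-list (as ++ bs) f ≈ ∑-list as f + ∑-list bs f
  ∑-++ []       bs = sym (+-identityˡ _)
  ∑-++ (a ∷ as) bs = trans (+-congˡ (∑-++ as bs)) (sym (+-assoc _ _ _))

  ∑-map : ∀ (g : A → B) (as : List A) {f : B → Carrier} → ∑-list (map g as) f ≈ ∑-list as (f ∘ g)
  ∑-map g []       = refl
  ∑-map g (a ∷ as) = +-congˡ (∑-map g as)

  ∑-concatMap : ∀ (g : A → List B) (as : List A) {f : B → Carrier} →
    ∑-list (concatMap g as) f ≈ ∑[ a ∈ as ] (∑-list (g a) f)
  ∑-concatMap g []       = refl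
  ∑-concatMap g (a ∷ as) = trans (∑-++ (g a) _) (+-congˡ (∑-concatMap g as))

  ∑-cartesianProductWith : ∀ (g : A → B → C) (as : List A) (bs : List B) {f : C → Carrier} →
    ∑-list (cartesianProductWith g as bs) f ≈ ∑[ a ∈ as ] (∑[ b ∈ bs ] f (g a b))
  ∑-cartesianProductWith g []       bs = refl
  ∑-cartesianProductWith g (a ∷ as) bs =
    trans (∑-++ (map (g a) bs) _) (+-cong (∑-map (g a) bs) (∑-cartesianProductWith g as bs))

  ∑-distribˡ-* : ∀ x (as : List A) {f : A → Carrier} → ∑[ a ∈ as ] (x * f a) ≈ x * ∑-list as f
  ∑-distribˡ-* x []       = sym (zeroʳ x)
  ∑-distribˡ-* x (a ∷ as) = trans (+-congˡ (∑-distribˡ-* x as)) (sym (distribˡ x _ _))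

  ∑-distribʳ-* : ∀ x (as : List A) {f : A → Carrier} → ∑[ a ∈ as ] (f a * x) ≈ ∑-list as f * x
  ∑-distribʳ-* x as = trans (∑-cong as (λ a → *-comm _ x)) (trans (∑-distribˡ-* x as) (*-comm x _))

  -- General distributivity, by induction on the number of factors. The index types may differ from
  -- factor to factor, as they must for subsets of shrinking sets of trials.
  ∑-families : ∀ {k} {A : Fin k → Set a} (as : ∀ j → List (A j)) (f : ∀ j → A j → Carrier) →
    ∑[ m ∈ families as ] (∏ λ j → f j (m j)) ≈ ∏ λ j → ∑-list (as j) (f j)
  ∑-families {k = zero}  as f = +-identityʳ 1#
  ∑-families {k = suc k} as f = begin
    ∑[ m ∈ families as ] (∏ λ j → f j (m j))
      ≈⟨ ∑-cartesianProductWith _ (as zero) (families (as ∘ suc)) ⟩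
    ∑[ a ∈ as zero ] (∑[ m ∈ families (as ∘ suc) ] (f zero a * ∏ λ j → f (suc j) (m j)))
      ≈⟨ ∑-cong (as zero) (λ a → ∑-distribˡ-* (f zero a) (families (as ∘ suc))) ⟩
    ∑[ a ∈ as zero ] (f zero a * (∑[ m ∈ families (as ∘ suc) ] (∏ λ j → f (suc j) (m j))))
      ≈⟨ ∑-distribʳ-* _ (as zero) ⟩
    ∑-list (as zero) (f zero) * (∑[ m ∈ families (as ∘ suc) ] (∏ λ j → f (suc j) (m j)))
      ≈⟨ *-congˡ (∑-families (as ∘ suc) (λ j → f (suc j))) ⟩
    ∑-list (as zero) (f zero) * (∏ λ j → ∑-list (as (suc j)) (f (suc j))) ∎

  -- An indicator weight. It moves the condition of a filtered sum into the summand, where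
  -- equivalent conditions can be exchanged. It looks only at `does`, so equivalent decisions give
  -- propositionally equal weights.
  when : ∀ {P : Set ℓ} → Dec P → Carrier → Carrier
  when P? x = if does P? then x else 0#

  when-⇔ : ∀ {P : Set ℓ} {Q : Set ℓ′} (P? : Dec P) (Q? : Dec Q) → P ⇔ Q →
    ∀ {x} → when P? x ≡ when Q? x
  when-⇔ P? Q? P⇔Q {x} = ≡.cong (if_then x else 0#) (does-⇔ P⇔Q P? Q?)

  ∑-filter : ∀ {P : Pred A ℓ} (P? : Decidable P) (as : List A) {f : A → Carrier} →
    ∑-list (filter P? as) f ≈ ∑[ a ∈ as ] when (P? a) (f a)
  ∑-filter P? []       = refl
  ∑-filter P? (a ∷ as) with P? a
  ... | yes _ = +-congˡ (∑-filter P? as)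
  ... | no  _ = trans (∑-filter P? as) (sym (+-identityˡ _))

  ∑-filter-cong : ∀ {P : Pred A ℓ} (P? : Decidable P) (as : List A) {f g : A → Carrier} →
    (∀ a → P a → f a ≈ g a) → ∑-list (filter P? as) f ≈ ∑-list (filter P? as) g
  ∑-filter-cong P? []       f≈g = refl
  ∑-filter-cong P? (a ∷ as) f≈g with P? a
  ... | yes Pa = +-cong (f≈g a Pa) (∑-filter-cong P? as f≈g)
  ... | no  _  = ∑-filter-cong P? as f≈g

  -- Complementation permutes the subsets: it swaps those without the first element and those with
  -- it, and acts recursively on the rest.
  ∑-subsets-∁ : ∀ n (f : Subset n → Carrier) → ∑-list (subsets n) (f ∘ ∁) ≈ ∑-list (subsets n) f
  ∑-subsets-∁ zero    f = refl
  ∑-subsets-∁ (suc n) f = begin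
    ∑-list (map (outside ∷_) Σₙ ++ map (inside ∷_) Σₙ) (f ∘ ∁)            ≈⟨ split (f ∘ ∁) ⟩
    ∑-list Σₙ (f ∘ (inside ∷_) ∘ ∁) + ∑-list Σₙ (f ∘ (outside ∷_) ∘ ∁)    ≈⟨ +-comm _ _ ⟩
    ∑-list Σₙ (f ∘ (outside ∷_) ∘ ∁) + ∑-list Σₙ (f ∘ (inside ∷_) ∘ ∁)
      ≈⟨ +-cong (∑-subsets-∁ n (f ∘ (outside ∷_))) (∑-subsets-∁ n (f ∘ (inside ∷_))) ⟩
    ∑-list Σₙ (f ∘ (outside ∷_)) + ∑-list Σₙ (f ∘ (inside ∷_))            ≈⟨ split f ⟨
    ∑-list (map (outside ∷_) Σₙ ++ map (inside ∷_) Σₙ) f                  ∎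
    where
    Σₙ = subsets n
    split : ∀ g → ∑-list (map (outside ∷_) Σₙ ++ map (inside ∷_) Σₙ) g
                ≈ ∑-list Σₙ (g ∘ (outside ∷_)) + ∑-list Σₙ (g ∘ (inside ∷_))
    split g = trans (∑-++ (map (outside ∷_) Σₙ) _) (+-cong (∑-map _ Σₙ) (∑-map _ Σₙ))

  -- As an indicator, the size condition can be restated for `∁ s`; the whole summand is then a
  -- function of `∁ s` and can be reindexed. This passes from success sets to failure sets.
  ∑-combinations-∁ : ∀ {m N} → m ℕ.≤ N → (f : Subset N → Carrier) →
    ∑-list (combinations m N) (f ∘ ∁) ≈ ∑-list (combinations (N ∸ m) N) f
  ∑-combinations-∁ {m} {N} m≤N f = begin
    ∑-list (combinations m N) (f ∘ ∁)
      ≈⟨ ∑-filter (λ s → ∣ s ∣ ℕ.≟ m) (subsets N) ⟩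
    ∑[ s ∈ subsets N ] when (∣ s ∣ ℕ.≟ m) (f (∁ s))
      ≈⟨ ∑-cong (subsets N) (λ s → reflexive (when-⇔ (∣ s ∣ ℕ.≟ m) (∣ ∁ s ∣ ℕ.≟ N ∸ m) (∣∁∣-⇔ m≤N s))) ⟩
    ∑[ s ∈ subsets N ] when (∣ ∁ s ∣ ℕ.≟ N ∸ m) (f (∁ s))
      ≈⟨ ∑-subsets-∁ N (λ s → when (∣ s ∣ ℕ.≟ N ∸ m) (f s)) ⟩
    ∑[ s ∈ subsets N ] when (∣ s ∣ ℕ.≟ N ∸ m) (f s)
      ≈⟨ ∑-filter (λ s → ∣ s ∣ ℕ.≟ N ∸ m) (subsets N) ⟨
    ∑-list (combinations (N ∸ m) N) f ∎

  -- Products over a subset and its complement.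

  ∏-subset-cong : ∀ (s : Subset n) {f g : Fin n → Carrier} → (∀ i → f i ≈ g i) → ∏-subset s f ≈ ∏-subset s g
  ∏-subset-cong []            f≈g = refl
  ∏-subset-cong (outside ∷ s) f≈g = ∏-subset-cong s (f≈g ∘ suc)
  ∏-subset-cong (inside  ∷ s) f≈g = *-cong (f≈g zero) (∏-subset-cong s (f≈g ∘ suc))

  ∏-subset-distrib-* : ∀ (s : Subset n) (f g : Fin n → Carrier) →
    ∏[ i ∈ s ] (f i * g i) ≈ ∏-subset s f * ∏-subset s g
  ∏-subset-distrib-* []            f g = sym (*-identityˡ 1#)
  ∏-subset-distrib-* (outside ∷ s) f g = ∏-subset-distrib-* s (f ∘ suc) (g ∘ suc)
  ∏-subset-distrib-* (inside  ∷ s) f g =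
    trans (*-congˡ (∏-subset-distrib-* s (f ∘ suc) (g ∘ suc))) (*-interchange _ _ _ _)

  ∏-subset-∁ : ∀ (s : Subset n) (f : Fin n → Carrier) → ∏-subset s f * ∏-subset (∁ s) f ≈ ∏ f
  ∏-subset-∁ []            f = *-identityˡ 1#
  ∏-subset-∁ (outside ∷ s) f = trans (x∙yz≈y∙xz _ _ _) (*-congˡ (∏-subset-∁ s (f ∘ suc)))
  ∏-subset-∁ (inside  ∷ s) f = trans (*-assoc _ _ _) (*-congˡ (∏-subset-∁ s (f ∘ suc)))

  -- Factorisation of the probability over the stages.

  stageMass : ∀ {N} → (∀ i → .{{NonZero i}} → Carrier) → Subset N → Carrier
  stageMass p s = (∏[ i ∈ s ] p (suc (toℕ i))) * (∏[ i ∈ ∁ s ] (1# - p (suc (toℕ i))))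

  -- Once the size of the first stage's success set is fixed, the later stages
  -- no longer depend on the set itself, so the probability factorises.
  ℙ-X≗ : ∀ {k} n (p : SuccessProbabilities k) (x : Vector ℕ k) →
    ℙ {n = n} p (X≟ x) ≈ ∏ λ j → ∑-list (combinations (x j) (n ∸ before x j)) (stageMass (p j))
  ℙ-X≗ {zero}  n p x = +-identityʳ 1#
  ℙ-X≗ {suc k} n p x = begin
    ℙ {n = n} p (X≟ x)
      ≈⟨ ∑-filter (X≟ x) (outcomes (suc k) n) ⟩
    ∑[ ω ∈ outcomes (suc k) n ] when (X≟ x ω) (mass p ω)
      ≈⟨ ∑-concatMap (λ s → map (s ∷_) (outcomes k (n ∸ ∣ s ∣))) (subsets n) ⟩
    ∑[ s ∈ subsets n ] (∑[ ω ∈ map (s ∷_) (outcomes k (n ∸ ∣ s ∣)) ] when (X≟ x ω) (mass p ω))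
      ≈⟨ ∑-cong (subsets n) (λ s → trans (∑-map (s ∷_) (outcomes k (n ∸ ∣ s ∣))) (given s (∣ s ∣ ℕ.≟ x zero))) ⟩
    ∑[ s ∈ subsets n ] (when (∣ s ∣ ℕ.≟ x zero) (stageMass (p zero) s) * rest (x zero))
      ≈⟨ ∑-distribʳ-* (rest (x zero)) (subsets n) ⟩
    (∑[ s ∈ subsets n ] when (∣ s ∣ ℕ.≟ x zero) (stageMass (p zero) s)) * rest (x zero)
      ≈⟨ *-cong (sym (∑-filter (λ s → ∣ s ∣ ℕ.≟ x zero) (subsets n))) (ℙ-X≗ (n ∸ x zero) p′ x′) ⟩
    ∑-list (combinations (x zero) n) (stageMass (p zero))
      * (∏ λ j → ∑-list (combinations (x′ j) (n ∸ x zero ∸ before x′ j)) (stageMass (p′ j)))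
      ≈⟨ *-congˡ (∏-cong λ j → reflexive (≡.cong (λ N → ∑-list (combinations (x′ j) N) (stageMass (p′ j)))
           (ℕ.∸-+-assoc n (x zero) (before x′ j)))) ⟩
    (∏ λ j → ∑-list (combinations (x j) (n ∸ before x j)) (stageMass (p j))) ∎
    where
    p′ : SuccessProbabilities k
    p′ j = p (suc j)
    x′ : Vector ℕ k
    x′ = x ∘ suc
    -- The type of the remaining outcomes depends on `∣ s ∣`. As a function of this number, the
    -- remaining probability can be rewritten by congruence, with no transport of outcomes.
    rest : ℕ → Carrier
    rest m = ℙ {n = n ∸ m} p′ (X≟ x′)

    -- Taking the decision as an argument lets the cases split on it while the event on `s ∷ ω`
    -- stays untouched.
    given : ∀ s (∣s∣≟x₀ : Dec (∣ s ∣ ≡ x zero)) →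
      ∑[ ω ∈ outcomes k (n ∸ ∣ s ∣) ] when (X≟ x (s ∷ ω)) (stageMass (p zero) s * mass p′ ω)
        ≈ when ∣s∣≟x₀ (stageMass (p zero) s) * rest (x zero)
    given s (yes ∣s∣≡x₀) = begin
      ∑[ ω ∈ Ω ] when (X≟ x (s ∷ ω)) (w * mass p′ ω)
        ≈⟨ ∑-cong Ω (λ ω → reflexive (when-⇔ (X≟ x (s ∷ ω)) (X≟ x′ ω)
             (mk⇔ (_∘ suc) λ { h zero → ∣s∣≡x₀ ; h (suc j) → h j }))) ⟩
      ∑[ ω ∈ Ω ] when (X≟ x′ ω) (w * mass p′ ω)    ≈⟨ ∑-filter (X≟ x′) Ω ⟨
      ∑[ ω ∈ filter (X≟ x′) Ω ] (w * mass p′ ω)    ≈⟨ ∑-distribˡ-* w (filter (X≟ x′) Ω) ⟩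
      w * rest ∣ s ∣                               ≡⟨ ≡.cong (λ m → w * rest m) ∣s∣≡x₀ ⟩
      w * rest (x zero)                            ∎
      where
      Ω = outcomes k (n ∸ ∣ s ∣)
      w = stageMass (p zero) s
    given s (no ∣s∣≢x₀) = begin
      ∑[ ω ∈ Ω ] when (X≟ x (s ∷ ω)) (w * mass p′ ω)
        -- The event fails already at its first component. Exchanging it for a decision that is
        -- literally `no` makes the weight compute to `0#`.
        ≈⟨ ∑-cong Ω (λ ω → reflexive (when-⇔ (X≟ x (s ∷ ω)) (no ∣s∣≢x₀)
             (mk⇔ (λ h → h zero) λ ∣s∣≡x₀ → contradiction ∣s∣≡x₀ ∣s∣≢x₀))) ⟩
      ∑[ ω ∈ Ω ] 0#                 ≈⟨ ∑-cong Ω (λ _ → sym (zeroˡ 0#)) ⟩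
      ∑[ ω ∈ Ω ] (0# * 0#)          ≈⟨ ∑-distribˡ-* 0# Ω ⟩
      0# * (∑[ ω ∈ Ω ] 0#)          ≈⟨ zeroˡ _ ⟩
      0#                            ≈⟨ zeroˡ _ ⟨
      0# * rest (x zero)            ∎
      where
      Ω = outcomes k (n ∸ ∣ s ∣)
      w = stageMass (p zero) s

  -- Reciprocals, q-numbers and powers of `q`.

  ι-+ : ∀ m n → ι (m ℕ.+ n) ≈ ι m + ι n
  ι-+ = ×-homo-+ 1#

  recip-unique : ∀ {x y} (0<y : 0# < y) → x * y ≈ 1# → x ≈ recip y 0<y
  recip-unique {x} {y} 0<y xy≈1 = begin
    x             ≈⟨ *-identityʳ x ⟨
    x * 1#        ≈⟨ *-congˡ (recip-inverseˡ 0<y) ⟨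
    x * (z * y)   ≈⟨ x∙yz≈y∙xz x z y ⟩
    z * (x * y)   ≈⟨ *-congˡ xy≈1 ⟩
    z * 1#        ≈⟨ *-identityʳ z ⟩
    z             ∎
    where z = recip y 0<y

  module _ (q : Carrier) (0<q : 0# < q) (q<1 : q < 1#) where
    open QNumbers ℝ q 0<q q<1

    q^-cong : ∀ {s t} → s ≈ t → q^ s ≈ q^ t
    q^-cong = pow-cong refl

    []q-cong : ∀ {s t} → s ≈ t → [ s ]q ≈ [ t ]q
    []q-cong s≈t = *-congʳ (+-congˡ (-‿cong (q^-cong s≈t)))

    -- Divide 1 - q^(1+t) = (1 - q) + q (1 - q^t) by 1 - q.
    []q-suc : ∀ t → [ 1# + t ]q ≈ 1# + q * [ t ]q
    []q-suc t = begin
      (1# - q^ (1# + t)) * z                      ≈⟨ *-congʳ (+-congˡ (-‿cong (trans pow-+ (*-congʳ pow-1)))) ⟩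
      (1# - q * u) * z                            ≈⟨ *-congʳ (+-congˡ (\\-leftDividesʳ q (- (q * u)))) ⟨
      (1# + (- q + (q - q * u))) * z              ≈⟨ *-congʳ (+-assoc 1# (- q) _) ⟨
      ((1# - q) + (q - q * u)) * z                ≈⟨ distribʳ z (1# - q) _ ⟩
      (1# - q) * z + (q - q * u) * z              ≈⟨ +-cong (trans (*-comm _ z) (recip-inverseˡ _)) (*-congʳ factor) ⟩
      1# + (q * (1# - u)) * z                     ≈⟨ +-congˡ (*-assoc q _ z) ⟩
      1# + q * [ t ]q                             ∎
      where
      z = recip (1# - q) (x<y⇒0<y-x q<1)
      u = q^ t
      factor : q - q * u ≈ q * (1# - u)
      factor = sym (trans (distribˡ q 1# (- u)) (+-cong (*-identityʳ q) (sym (-‿distribʳ-* q u))))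

    ∏-subset-q* : ∀ (s : Subset n) (f : Fin n → Carrier) →
      ∏[ i ∈ s ] (q * f i) ≈ q^ (ι ∣ s ∣) * ∏-subset s f
    ∏-subset-q* []            f = sym (trans (*-congʳ pow-0) (*-identityˡ 1#))
    ∏-subset-q* (outside ∷ s) f = ∏-subset-q* s (f ∘ suc)
    ∏-subset-q* (inside  ∷ s) f = trans (*-congˡ (∏-subset-q* s (f ∘ suc)))
      (trans (*-interchange _ _ _ _) (*-congʳ (sym (trans pow-+ (*-congʳ pow-1)))))

    ∏-q^ι : ∀ {k} (m : Vector ℕ k) → (∏ λ j → q^ (ι (m j))) ≈ q^ (ι (∑ℕ m))
    ∏-q^ι {zero}  m = sym pow-0
    ∏-q^ι {suc k} m = trans (*-congˡ (∏-q^ι (m ∘ suc)))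
      (trans (sym pow-+) (q^-cong (sym (ι-+ (m zero) _))))

    -- A single stage with success probabilities 1/[r+i].

    module _ {r : Carrier} (0≤r : 0# ≤ r) where

      -- Unfolds to the probabilities in the theorem, so the results on one stage apply there
      -- without conversion.
      success : ∀ i → .{{NonZero i}} → Carrier
      success i = 1# / [ r + ι i ]q ⟨ [r+i]q-pos 0≤r i ⟩

      success-inverseˡ : ∀ i → .{{_ : NonZero i}} → success i * [ r + ι i ]q ≈ 1#
      success-inverseˡ i = trans (*-congʳ (*-identityˡ _)) (recip-inverseˡ _)

      -- Here `i` counts from zero and the trial has number `i + 1`. This shift is why the subsets
      -- in the multiple sum are taken from 0, ..., N - 1. The q-number [r + i], which vanishes for
      -- r = i = 0, occurs only as a numerator.
      failure : ∀ i → 1# - success (suc i) ≈ (q * [ r + ι i ]q) * success (suc i)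
      failure i = begin
        -- Writing `1#` as p [r+i+1] and expanding by the recurrence produces a summand `p` that
        -- cancels.
        1# - p                          ≈⟨ +-congʳ (success-inverseˡ (suc i)) ⟨
        p * [ r + ι (suc i) ]q - p      ≈⟨ +-congʳ (*-congˡ (trans ([]q-cong shift) ([]q-suc _))) ⟩
        p * (1# + y) - p                ≈⟨ +-congʳ (trans (distribˡ p 1# y) (+-congʳ (*-identityʳ p))) ⟩
        p + p * y - p                   ≈⟨ xyx⁻¹≈y p (p * y) ⟩
        p * y                           ≈⟨ *-comm p y ⟩
        y * p                           ∎
        where
        p = success (suc i)
        y = q * [ r + ι i ]q
        shift : r + ι (suc i) ≈ 1# + (r + ι i)
        shift = trans (sym (+-assoc r 1# _)) (trans (+-congʳ (+-comm r 1#)) (+-assoc 1# r _))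

      -- The falling factorial runs down from [r+N] to [r+1], the trials run upwards; reversing the
      -- index set matches the factors.
      [r+N]↓N≈∏ : ∀ N → [ r + ι N ]↓ N ≈ ∏ {N} λ i → [ r + ι (suc (toℕ i)) ]q
      [r+N]↓N≈∏ N = trans (∏-permute {N} {N} _ reverse) (∏-cong {N} λ i → []q-cong (begin
        r + ι N - ι (toℕ (reverse ⟨$⟩ʳ i))            ≡⟨ ≡.cong (λ m → r + ι N - ι m) (opposite-prop i) ⟩
        r + ι N - ι (N ∸ suc (toℕ i))                 ≈⟨ +-congʳ (+-congˡ (ι-N i)) ⟩
        r + (ι (N ∸ suc (toℕ i)) + ι (suc (toℕ i))) - ι (N ∸ suc (toℕ i))
          ≈⟨ +-assoc r _ _ ⟩
        r + (ι (N ∸ suc (toℕ i)) + ι (suc (toℕ i)) - ι (N ∸ suc (toℕ i)))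
          ≈⟨ +-congˡ (xyx⁻¹≈y _ _) ⟩
        r + ι (suc (toℕ i))                           ∎))
        where
        ι-N : ∀ (i : Fin N) → ι N ≈ ι (N ∸ suc (toℕ i)) + ι (suc (toℕ i))
        ι-N i = trans (reflexive (≡.cong ι (≡.sym (ℕ.m∸n+n≡m (toℕ<n i))))) (ι-+ (N ∸ suc (toℕ i)) (suc (toℕ i)))

      -- Stated as an inverse rather than as a reciprocal, so that the stages can be multiplied
      -- first and divided by only once.
      ∏-success-inverseˡ : ∀ N → (∏ {N} λ i → success (suc (toℕ i))) * [ r + ι N ]↓ N ≈ 1#
      ∏-success-inverseˡ N = begin
        (∏ {N} λ i → success (suc (toℕ i))) * [ r + ι N ]↓ N            ≈⟨ *-congˡ ([r+N]↓N≈∏ N) ⟩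
        (∏ {N} λ i → success (suc (toℕ i))) * (∏ {N} λ i → [ r + ι (suc (toℕ i)) ]q)
          ≈⟨ ∏-distrib-* {N} _ _ ⟨
        (∏ {N} λ i → success (suc (toℕ i)) * [ r + ι (suc (toℕ i)) ]q)
          ≈⟨ ∏-cong {N} (λ i → success-inverseˡ (suc (toℕ i))) ⟩
        (∏ {N} λ _ → 1#)                                                ≈⟨ ∏-1 N ⟩
        1#                                                              ∎

      -- Every trial contributes its own `u i`, whether it succeeds or fails, so these factors
      -- recombine into a product independent of `s`. A failure contributes `q * v i` in addition.
      stageMass-success : ∀ {N} (s : Subset N) → stageMass success s
        ≈ (q^ (ι ∣ ∁ s ∣) * (∏ {N} λ i → success (suc (toℕ i)))) * (∏[ i ∈ ∁ s ] [ r + ι (toℕ i) ]q)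
      stageMass-success {N} s = begin
        ∏-subset s u * (∏[ i ∈ ∁ s ] (1# - u i))
          ≈⟨ *-congˡ (∏-subset-cong (∁ s) (λ i → failure (toℕ i))) ⟩
        ∏-subset s u * (∏[ i ∈ ∁ s ] ((q * v i) * u i))
          ≈⟨ *-congˡ (∏-subset-distrib-* (∁ s) _ u) ⟩
        ∏-subset s u * ((∏[ i ∈ ∁ s ] (q * v i)) * ∏-subset (∁ s) u)
          ≈⟨ x∙yz≈y∙xz _ _ _ ⟩
        (∏[ i ∈ ∁ s ] (q * v i)) * (∏-subset s u * ∏-subset (∁ s) u)
          ≈⟨ *-cong (∏-subset-q* (∁ s) v) (∏-subset-∁ s u) ⟩
        (q^ (ι ∣ ∁ s ∣) * ∏-subset (∁ s) v) * ∏ u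
          ≈⟨ trans (*-assoc _ _ _) (trans (*-congˡ (*-comm _ _)) (sym (*-assoc _ _ _))) ⟩
        (q^ (ι ∣ ∁ s ∣) * ∏ u) * ∏-subset (∁ s) v ∎
        where
        u v : Fin N → Carrier
        u i = success (suc (toℕ i))
        v i = [ r + ι (toℕ i) ]q

      ∑-stageMass-success : ∀ {m N} → m ℕ.≤ N → ∑-list (combinations m N) (stageMass success)
        ≈ (q^ (ι (N ∸ m)) * (∏ {N} λ i → success (suc (toℕ i))))
          * (∑[ s ∈ combinations (N ∸ m) N ] ∏[ i ∈ s ] [ r + ι (toℕ i) ]q)
      ∑-stageMass-success {m} {N} m≤N = begin
        ∑-list (combinations m N) (stageMass success)
          -- The power of `q` depends on `s` through the number of failures, which is constant only
          -- under the size condition; hence a congruence restricted to the filtered subsets.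
          ≈⟨ ∑-filter-cong (λ s → ∣ s ∣ ℕ.≟ m) (subsets N) (λ s ∣s∣≡m → trans (stageMass-success s)
               (reflexive (≡.cong (λ l → (q^ (ι l) * P) * V (∁ s)) (Equivalence.to (∣∁∣-⇔ m≤N s) ∣s∣≡m)))) ⟩
        ∑[ s ∈ combinations m N ] ((q^ (ι (N ∸ m)) * P) * V (∁ s))
          ≈⟨ ∑-distribˡ-* _ (combinations m N) ⟩
        (q^ (ι (N ∸ m)) * P) * ∑-list (combinations m N) (V ∘ ∁)
          ≈⟨ *-congˡ (∑-combinations-∁ m≤N V) ⟩
        (q^ (ι (N ∸ m)) * P) * ∑-list (combinations (N ∸ m) N) V ∎
        where
        P = ∏ {N} λ i → success (suc (toℕ i))
        V : Subset N → Carrier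
        V s = ∏[ i ∈ s ] [ r + ι (toℕ i) ]q

theorem5 :
  ∀ {c ℓ₁ ℓ₂} (ℝ : RealNumbers c ℓ₁ ℓ₂) →
  let open RealNumbers ℝ
      open RealProperties ℝ
      open ChainComposite ℝ
  in
  (q : Carrier) (0<q : 0# < q) (q<1 : q < 1#) →
  let open QNumbers ℝ q 0<q q<1 in
  (k n : ℕ) → 1 ℕ.≤ k → 1 ℕ.≤ n →
  (r : Vector Carrier k) (0≤r : ∀ j → 0# ≤ r j) →
  let p : SuccessProbabilities k
      p j i = 1# / [ r j + ι i ]q ⟨ [r+i]q-pos (0≤r j) i ⟩
  in
  (x : Vector ℕ k) → (∀ j → x j ℕ.≤ n) → ∑ℕ x ℕ.≤ n →
  let trials : Vector ℕ k
      trials j = n ∸ before x j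
      failures : Vector ℕ k
      failures j = n ∸ upto x j
  in
  ℙ {n = n} p (X≟ x)
    ≈ (q^ (ι (n ℕ.* k) - ι (∑ℕ λ j → (k ∸ toℕ j) ℕ.* x j)))
        / (∏ λ j → [ r j + ι (trials j) ]↓ trials j)
          ⟨ ∏-pos _ (λ j → [r+N]↓N-pos (0≤r j) (trials j)) ⟩
      * (∑[ m ∈ families (λ j → combinations (failures j) (trials j)) ]
           (∏ λ j → ∏[ i ∈ m j ] [ r j + ι (toℕ i) ]q))
theorem5 ℝ q 0<q q<1 k n 1≤k 1≤n r 0≤r x x≤n ∑x≤n = begin
  ℙ {n = n} p (X≟ x)
    ≈⟨ ℙ-X≗ ℝ n p x ⟩
  (∏ λ j → ∑-list (combinations (x j) (trials j)) (stageMass ℝ (p j)))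
    ≈⟨ ∏-cong (λ j → stage j) ⟩
  (∏ λ j → (q^ (ι (failures j)) * P j) * S j)
    ≈⟨ trans (∏-distrib-* (λ j → q^ (ι (failures j)) * P j) S) (*-congʳ (∏-distrib-* _ P)) ⟩
  ((∏ λ j → q^ (ι (failures j))) * ∏ P) * ∏ S
    -- The powers of `q` add up to the total number of failures, the success factors merge into one
    -- reciprocal, and the product of sums becomes the multiple sum.
    ≈⟨ *-cong (*-cong (trans (∏-q^ι ℝ q 0<q q<1 failures) (pow-cong refl exponent)) denominator)
         (sym (∑-families ℝ (λ j → combinations (failures j) (trials j)) λ j s → ∏[ i ∈ s ] [ r j + ι (toℕ i) ]q)) ⟩
  (q^ (ι (n ℕ.* k) - ι E)) / (∏ D) ⟨ 0<∏D ⟩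
    * (∑[ m ∈ families (λ j → combinations (failures j) (trials j)) ]
         (∏ λ j → ∏[ i ∈ m j ] [ r j + ι (toℕ i) ]q)) ∎
  where
  open RealNumbers ℝ
  open RealProperties ℝ
  open ChainComposite ℝ
  open QNumbers ℝ q 0<q q<1
  open CommutativeRing commutativeRing using (*-commutativeMonoid; +-abelianGroup)
  open AbelianGroupProperties +-abelianGroup using (xyx⁻¹≈y)
  open CommutativeMonoidSum *-commutativeMonoid using () renaming
    (sum-cong-≋ to ∏-cong; ∑-distrib-+ to ∏-distrib-*; sum-replicate-zero to ∏-1)
  open SetoidReasoning setoid
  p : SuccessProbabilities k
  p j = success ℝ q 0<q q<1 (0≤r j)
  trials failures : Vector ℕ k
  trials j = n ∸ before x j
  failures j = n ∸ upto x j
  P S D : Vector Carrier k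
  P j = ∏ {trials j} λ i → p j (suc (toℕ i))
  S j = ∑[ s ∈ combinations (failures j) (trials j) ] ∏[ i ∈ s ] [ r j + ι (toℕ i) ]q
  D j = [ r j + ι (trials j) ]↓ trials j
  E = ∑ℕ λ j → (k ∸ toℕ j) ℕ.* x j
  0<∏D : 0# < ∏ D
  0<∏D = ∏-pos _ (λ j → [r+N]↓N-pos (0≤r j) (trials j))

  x≤trials : ∀ j → x j ℕ.≤ trials j
  x≤trials j = ℕ.m+n≤o⇒m≤o∸n (x j) (ℕ.≤-trans (ℕ.≤-reflexive (ℕ.+-comm (x j) _))
    (ℕ.≤-trans (upto≤∑ x j) ∑x≤n))

  stage : ∀ j → ∑-list (combinations (x j) (trials j)) (stageMass ℝ (p j))
              ≈ (q^ (ι (failures j)) * P j) * S j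
  stage j = trans (∑-stageMass-success ℝ q 0<q q<1 (0≤r j) (x≤trials j))
    -- The one-stage result counts failures as `trials j ∸ x j`; both the exponent and the subset
    -- size are rewritten to `n ∸ upto x j`.
    (reflexive (≡.cong
      (λ l → (q^ (ι l) * P j) * (∑[ s ∈ combinations l (trials j) ] ∏[ i ∈ s ] [ r j + ι (toℕ i) ]q))
      (ℕ.∸-+-assoc n (before x j) (x j))))

  exponent : ι (∑ℕ failures) ≈ ι (n ℕ.* k) - ι E
  exponent = begin
    -- `ι E` is added and subtracted because the count of failures is available only as a sum.
    ι (∑ℕ failures)                    ≈⟨ xyx⁻¹≈y (ι E) _ ⟨
    ι E + ι (∑ℕ failures) - ι E        ≈⟨ +-congʳ (+-comm _ _) ⟩
    ι (∑ℕ failures) + ι E - ι E        ≈⟨ +-congʳ (ι-+ ℝ (∑ℕ failures) E) ⟨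
    ι (∑ℕ failures ℕ.+ E) - ι E        ≡⟨ ≡.cong (λ m → ι m - ι E) (∑-failures k x n ∑x≤n) ⟩
    ι (n ℕ.* k) - ι E                  ∎

  denominator : ∏ P ≈ recip (∏ D) 0<∏D
  denominator = recip-unique ℝ 0<∏D (begin
    ∏ P * ∏ D              ≈⟨ ∏-distrib-* P D ⟨
    (∏ λ j → P j * D j)    ≈⟨ ∏-cong (λ j → ∏-success-inverseˡ ℝ q 0<q q<1 (0≤r j) (trials j)) ⟩
    (∏ {k} λ _ → 1#)       ≈⟨ ∏-1 k ⟩
    1#                     ∎)
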